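{- Let $Q_4$ be the edge graph of the $4$-dimensional hypercube (vertices $\{0,1\}^4$, two vertices adjacent iff they differ in exactly one coordinate). Up to a permutation of the colours (simultaneous permutation of rows and columns of the colour adjacency matrix), the colour adjacency matrices of perfect $2$-colourings of $Q_4$ are exactly the five matrices \[ \begin{pmatrix} 0 & 4 \\ 4 & 0 \end{pmatrix}, \begin{pmatrix} 1 & 3 \\ 1 & 3 \end{pmatrix}, \begin{pmatrix} 1 & 3 \\ 3 & 1 \end{pmatrix}, \begin{pmatrix} 2 & 2 \\ 2 & 2 \end{pmatrix}, \begin{pmatrix} 3 & 1 \\ 1 & 3 \end{pmatrix}, \] and the colour adjacency matrices of perfect $3$-colourings of $Q_4$ are exactly the five matrices \[ \begin{pmatrix} 0 & 0 & 4 \\ 0 & 0 & 4 \\ 1 & 3 & 0 \end{pmatrix}, \begin{pmatrix} 0 & 0 & 4 \\ 0 & 0 & 4 \\ 2 & 2 & 0 \end{pmatrix}, \begin{pmatrix} 0 & 2 & 2 \\ 2 & 0 & 2 \\ 1 & 1 & 2 \end{pmatrix}, \begin{pmatrix} 1 & 1 & 2 \\ 1 & 1 & 2 \\ 1 & 1 & 2 \end{pmatrix}, \begin{pmatrix} 2 & 0 & 2 \\ 0 & 2 & 2 \\ 1 & 1 & 2 \end{pmatrix}. \] In particular each of these matrices is realized by some perfect colouring of $Q_4$.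
   Context: An $m$-colouring of a graph $G=(V,E)$ is a partition of $V$ into $m$ disjoint nonempty sets $V_1,\dots,V_m$ (the colours; adjacent vertices may have the same colour). It is perfect if for all $i,j$ every vertex of colour $i$ has the same number $a_{ij}$ of neighbours of colour $j$; the matrix $A=(a_{ij})$ is its colour adjacency matrix. Relabelling colours by a permutation $\sigma$ replaces $A$ by $(a_{\sigma(i)\sigma(j)})$. -}

module Defs where

open import Data.Bool.Base using (Bool; true; false)
import Data.Bool.Properties as Bool
open import Data.Fin.Base using (Fin)
import Data.Fin.Properties as Fin
open import Data.Fin.Permutation using (Permutation′; _⟨$⟩ʳ_)
open import Data.List.Base using (List; []; _∷_; length; filter; cartesianProductWith)
open import Data.List.Membership.Propositional using (_∈_)
open import Data.List.Membership.Propositional.Properties using (∈-cartesianProductWith⁺)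
open import Data.List.Relation.Unary.Any using (here; there)
open import Data.List.Relation.Unary.All using ([]; _∷_)
open import Data.List.Relation.Unary.AllPairs using ([]; _∷_)
open import Data.List.Relation.Unary.Unique.Propositional using (Unique)
import Data.List.Relation.Unary.Unique.Propositional.Properties as Unique
open import Data.Nat.Base using (ℕ; zero; suc)
open import Data.Product using (∃; ∃!; _,_)
open import Data.Vec.Base using (Vec; []; _∷_; lookup)
import Data.Vec.Properties as Vec
open import Function.Base using (_∘_)
open import Function.Definitions using (StrictlySurjective)
open import Relation.Binary.Core using (Rel)
open import Relation.Binary.Definitions using (Decidable; Symmetric; Irreflexive)
open import Relation.Binary.PropositionalEquality using (_≡_; _≢_; refl; sym)
open import Relation.Nullary.Decidable using (map′; ¬?; _×-dec_; _→-dec_)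
open import Level using (0ℓ)

-- Finite simple graphs.  The duplicate-free list of all vertices is only
-- used to count neighbours.
record FiniteGraph : Set₁ where
  field
    Vertex      : Set
    Adj         : Rel Vertex 0ℓ
    adj-sym     : Symmetric Adj
    adj-irrefl  : Irreflexive _≡_ Adj
    adj?        : Decidable Adj
    vertices    : List Vertex
    complete    : ∀ v → v ∈ vertices
    unique      : Unique vertices

Matrix : ℕ → Set
Matrix m = Vec (Vec ℕ m) m

entry : ∀ {m} → Matrix m → Fin m → Fin m → ℕ
entry A i j = lookup (lookup A i) j

infix 4 _∼_

_∼_ : ∀ {m} → Rel (Matrix m) 0ℓ
_∼_ {m} A B = ∃ λ (σ : Permutation′ m) →
  ∀ i j → entry A i j ≡ entry B (σ ⟨$⟩ʳ i) (σ ⟨$⟩ʳ j)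

module _ (G : FiniteGraph) where
  open FiniteGraph G

  -- A partition of the vertices into m disjoint labelled nonempty sets:
  -- the i-th set is the fibre of colour over i.
  record Colouring (m : ℕ) : Set where
    field
      colour   : Vertex → Fin m
      nonempty : StrictlySurjective _≡_ colour

    neighbours : Vertex → Fin m → ℕ
    neighbours v j =
      length (filter (λ w → adj? v w ×-dec (colour w Fin.≟ j)) vertices)

  -- By nonemptiness of the colour classes, the matrix is determined by
  -- the colouring.
  record PerfectColouring (m : ℕ) : Set where
    field
      colouring : Colouring m
    open Colouring colouring public
    field
      matrix  : Matrix m
      perfect : ∀ i j v → colour v ≡ i → neighbours v j ≡ entry matrix i j

  IsColourAdjacencyMatrix : ∀ {m} → Matrix m → Set
  IsColourAdjacencyMatrix {m} A =
    ∃ λ (P : PerfectColouring m) → PerfectColouring.matrix P ≡ A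

Differ : ∀ {n} → Vec Bool n → Vec Bool n → Fin n → Set
Differ u v i = lookup u i ≢ lookup v i

DifferInOne : ∀ {n} → Rel (Vec Bool n) 0ℓ
DifferInOne u v = ∃! _≡_ (Differ u v)

differInOne? : ∀ {n} → Decidable (DifferInOne {n})
differInOne? u v = Fin.any? λ i →
  differ? i ×-dec
  map′ (λ h {j} → h j) (λ h j → h {j})
       (Fin.all? λ j → differ? j →-dec (i Fin.≟ j))
  where
  differ? = λ i → ¬? (lookup u i Bool.≟ lookup v i)

bitVectors : ∀ n → List (Vec Bool n)
bitVectors zero    = [] ∷ []
bitVectors (suc n) = cartesianProductWith _∷_ (false ∷ true ∷ []) (bitVectors n)

bitVectors-complete : ∀ {n} (v : Vec Bool n) → v ∈ bitVectors n
bitVectors-complete []      = here refl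
bitVectors-complete (b ∷ v) =
  ∈-cartesianProductWith⁺ _∷_ (bit b) (bitVectors-complete v)
  where
  bit : ∀ b → b ∈ false ∷ true ∷ []
  bit false = here refl
  bit true  = there (here refl)

bitVectors-unique : ∀ n → Unique (bitVectors n)
bitVectors-unique zero    = [] ∷ []
bitVectors-unique (suc n) =
  Unique.cartesianProductWith⁺ _∷_ Vec.∷-injective
    (((λ ()) ∷ []) ∷ [] ∷ []) (bitVectors-unique n)

Q : ℕ → FiniteGraph
Q n = record
  { Vertex     = Vec Bool n
  ; Adj        = DifferInOne
  ; adj-sym    = λ { (i , d , u) → i , d ∘ sym , λ d′ → u (d′ ∘ sym) }
  ; adj-irrefl = λ { refl (i , d , _) → d refl }
  ; adj?       = differInOne?
  ; vertices   = bitVectors n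
  ; complete   = bitVectors-complete
  ; unique     = bitVectors-unique n
  }

matrices₂ : List (Matrix 2)
matrices₂ =
    ((0 ∷ 4 ∷ []) ∷
     (4 ∷ 0 ∷ []) ∷ [])
  ∷ ((1 ∷ 3 ∷ []) ∷
     (1 ∷ 3 ∷ []) ∷ [])
  ∷ ((1 ∷ 3 ∷ []) ∷
     (3 ∷ 1 ∷ []) ∷ [])
  ∷ ((2 ∷ 2 ∷ []) ∷
     (2 ∷ 2 ∷ []) ∷ [])
  ∷ ((3 ∷ 1 ∷ []) ∷
     (1 ∷ 3 ∷ []) ∷ [])
  ∷ []

matrices₃ : List (Matrix 3)
matrices₃ =
    ((0 ∷ 0 ∷ 4 ∷ []) ∷
     (0 ∷ 0 ∷ 4 ∷ []) ∷
     (1 ∷ 3 ∷ 0 ∷ []) ∷ [])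
  ∷ ((0 ∷ 0 ∷ 4 ∷ []) ∷
     (0 ∷ 0 ∷ 4 ∷ []) ∷
     (2 ∷ 2 ∷ 0 ∷ []) ∷ [])
  ∷ ((0 ∷ 2 ∷ 2 ∷ []) ∷
     (2 ∷ 0 ∷ 2 ∷ []) ∷
     (1 ∷ 1 ∷ 2 ∷ []) ∷ [])
  ∷ ((1 ∷ 1 ∷ 2 ∷ []) ∷
     (1 ∷ 1 ∷ 2 ∷ []) ∷
     (1 ∷ 1 ∷ 2 ∷ []) ∷ [])
  ∷ ((2 ∷ 0 ∷ 2 ∷ []) ∷
     (0 ∷ 2 ∷ 2 ∷ []) ∷
     (1 ∷ 1 ∷ 2 ∷ []) ∷ [])
  ∷ []

{-# OPTIONS --safe #-}
-- In a perfect colouring of Q n the number of vertices of colour j at distance k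
-- from a vertex depends only on the colour i of that vertex, and the resulting
-- matrices D k are determined by the colour adjacency matrix A:
--   A D(k+1) + k D(k) = n D(k) + (k+2) D(k+2),   D(0) = 1,   D(1) = A.
-- Hence every division by k + 2 in this recurrence is exact and every subtraction
-- stays in ℕ; moreover, for all i and j some D k with k ≤ n has a positive (i , j)
-- entry, since all colours occur.  For n = 4 and two or three colours, the matrices
-- with row sums 4 that pass this test are exactly the listed ones and their
-- relabellings, and each listed one comes from an explicit colouring.
module Submission where

open import Defs
open import Algebra.Properties.CommutativeSemigroup using (interchange)
open import Data.Bool.Base using (Bool; true; false; not; _∨_; _xor_; if_then_else_)
import Data.Bool.Properties as Bool
open import Data.Fin.Base using (Fin; zero; suc; punchIn)
open import Data.Fin.Patterns using (0F; 1F; 2F)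
open import Data.Fin.Permutation
  using (Permutation′; _⟨$⟩ʳ_; _⟨$⟩ˡ_; inverseˡ; inverseʳ; id; insert; remove; insert-remove; _≈_)
import Data.Fin.Properties as Fin
open import Data.List.Base
  using (List; []; _∷_; _++_; map; length; filter; cartesianProductWith; allFin; upTo)
open import Data.List.Membership.Propositional using (_∈_)
open import Data.List.Membership.Propositional.Properties
  using (∈-cartesianProductWith⁺; ∈-filter⁺; ∈-allFin; ∈-upTo⁺)
open import Data.List.Properties using (filter-++; filter-≐; filter-none; length-++; ++-identityʳ)
open import Data.List.Relation.Unary.All as All using (All; []; _∷_)
open import Data.List.Relation.Unary.AllPairs using (AllPairs; allPairs?)
open import Data.List.Relation.Unary.Any as Any using (Any; here)
import Data.List.Relation.Unary.Any.Properties as Any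
open import Data.Nat.Base using (ℕ; zero; suc; _+_; _*_; _∸_; _/_; _≤_; _<_; z≤n; s≤s)
open import Data.Nat.DivMod using (m*n/n≡m)
open import Data.Nat.Properties
open import Data.Nat.Tactic.RingSolver using (solve-∀)
open import Algebra.Properties.Semiring.Sum +-*-semiring using (sum-syntax; sum-cong-≗; sum-replicate-zero; ∑-distrib-+)
open import Data.Product using (_×_; ∃; _,_; proj₁; proj₂)
import Data.Product as Product
open import Data.Vec.Base using (Vec; []; _∷_; lookup)
import Data.Vec.Properties as Vec
open import Function.Base using (_∘_; const)
open import Function.Bundles using (_⇔_; mk⇔)
open import Relation.Binary.Definitions using (Decidable)
open import Relation.Binary.PropositionalEquality
open import Relation.Nullary using (¬_; Dec; yes; no; does; contradiction)
open import Relation.Nullary.Decidable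
  using (map′; ¬?; _×-dec_; _→-dec_; dec-true; True; toWitness; from-yes)
open import Relation.Unary using (Pred; _≐_)
import Relation.Unary as U
open import Level using (0ℓ)

⟦_⟧ : ∀ {P : Set} → Dec P → ℕ
⟦ P? ⟧ = if does P? then 1 else 0

-- Sums over spheres of the hypercube

private variable
  m n : ℕ

-- Sums `f` over the points at Hamming distance `k` from `v`, split by whether the first coordinate
-- is kept or flipped.
sphere : ℕ → (Vec Bool n → ℕ) → Vec Bool n → ℕ
sphere zero    f v       = f v
sphere (suc k) f []      = 0
sphere (suc k) f (b ∷ v) = sphere (suc k) (f ∘ (b ∷_)) v + sphere k (f ∘ (not b ∷_)) v

sphere-cong : ∀ k {f g : Vec Bool n → ℕ} → f ≗ g → sphere k f ≗ sphere k g
sphere-cong zero    f≗g v       = f≗g v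
sphere-cong (suc k) f≗g []      = refl
sphere-cong (suc k) f≗g (b ∷ v) =
  cong₂ _+_ (sphere-cong (suc k) (f≗g ∘ (b ∷_)) v) (sphere-cong k (f≗g ∘ (not b ∷_)) v)

sphere-+ : ∀ k (f g : Vec Bool n → ℕ) v →
           sphere k (λ w → f w + g w) v ≡ sphere k f v + sphere k g v
sphere-+ zero    f g v       = refl
sphere-+ (suc k) f g []      = refl
sphere-+ (suc k) f g (b ∷ v) = trans
  (cong₂ _+_ (sphere-+ (suc k) (f ∘ (b ∷_)) (g ∘ (b ∷_)) v)
             (sphere-+ k (f ∘ (not b ∷_)) (g ∘ (not b ∷_)) v))
  (interchange +-commutativeSemigroup (sphere (suc k) (f ∘ (b ∷_)) v) _ _ _)

-- S_1 S_{k+1} = (n − k) S_k + (k + 2) S_{k+2}, with k S_k moved to the left so that no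
-- subtraction occurs.
sphere-recurrence : ∀ k (f : Vec Bool n → ℕ) v →
  sphere 1 (sphere (suc k) f) v + k * sphere k f v
    ≡ n * sphere k f v + (2 + k) * sphere (2 + k) f v
sphere-recurrence zero    f [] = refl
sphere-recurrence (suc k) f [] = trans (*-zeroʳ k) (sym (*-zeroʳ k))
sphere-recurrence {suc n} k f (b ∷ v) = trans (cong (_+ k * sphere k f (b ∷ v)) (split b)) (step k)
  where
  g = f ∘ (b ∷_)
  h = f ∘ (not b ∷_)

  -- `b` is matched because `not (not b)` reduces only on constructors.
  split : ∀ b → let g = f ∘ (b ∷_); h = f ∘ (not b ∷_) in
    sphere 1 (sphere (suc k) f) (b ∷ v)
      ≡ (sphere 1 (sphere (suc k) g) v + sphere 1 (sphere k h) v)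
        + (sphere (suc k) h v + sphere k g v)
  split false = cong (_+ (sphere (suc k) (f ∘ (true ∷_)) v + sphere k (f ∘ (false ∷_)) v))
    (sphere-+ 1 (sphere (suc k) (f ∘ (false ∷_))) (sphere k (f ∘ (true ∷_))) v)
  split true = cong (_+ (sphere (suc k) (f ∘ (false ∷_)) v + sphere k (f ∘ (true ∷_)) v))
    (sphere-+ 1 (sphere (suc k) (f ∘ (true ∷_))) (sphere k (f ∘ (false ∷_))) v)

  step : ∀ k →
    (sphere 1 (sphere (suc k) g) v + sphere 1 (sphere k h) v)
      + (sphere (suc k) h v + sphere k g v) + k * sphere k f (b ∷ v)
    ≡ suc n * sphere k f (b ∷ v) + (2 + k) * sphere (2 + k) f (b ∷ v)
  step zero = trans
    (rearrange (sphere 1 (sphere 1 g) v) (sphere 1 h v) (g v))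
    (trans (cong (_+ (sphere 1 h v + sphere 1 h v + g v)) (sphere-recurrence 0 g v))
      (collect n (g v) (sphere 2 g v) (sphere 1 h v)))
    where
    rearrange : ∀ a b c → (a + b) + (b + c) + 0 ≡ (a + 0) + (b + b + c)
    rearrange = solve-∀
    collect : ∀ n g₀ g₂ h₁ → (n * g₀ + 2 * g₂) + (h₁ + h₁ + g₀) ≡ suc n * g₀ + 2 * (g₂ + h₁)
    collect = solve-∀
  -- Flipping the first bit uses up one unit of distance, so the half `h` enters with index `k`.
  step (suc k) = trans
    (rearrange k (sphere 1 (sphere (2 + k) g) v) (sphere 1 (sphere (suc k) h) v)
       (sphere (2 + k) h v) (sphere (suc k) g v) (sphere k h v))
    (trans (cong₂ (λ x y → x + y + (sphere (2 + k) h v + sphere (suc k) g v + sphere k h v))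
              (sphere-recurrence (suc k) g v) (sphere-recurrence k h v))
      (collect n k (sphere (suc k) g v) (sphere (3 + k) g v)
         (sphere k h v) (sphere (2 + k) h v)))
    where
    rearrange : ∀ k x y h₂ g₁ h₀ →
      (x + y) + (h₂ + g₁) + suc k * (g₁ + h₀)
        ≡ (x + suc k * g₁) + (y + k * h₀) + (h₂ + g₁ + h₀)
    rearrange = solve-∀
    collect : ∀ n k g₁ g₃ h₀ h₂ →
      (n * g₁ + (3 + k) * g₃) + (n * h₀ + (2 + k) * h₂) + (h₂ + g₁ + h₀)
        ≡ suc n * (g₁ + h₀) + (3 + k) * (g₃ + h₂)
    collect = solve-∀

sphere-1-const : ∀ (v : Vec Bool n) → sphere 1 (const 1) v ≡ n
sphere-1-const []      = refl
sphere-1-const (b ∷ v) = trans (+-comm _ 1) (cong suc (sphere-1-const v))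

-- `k` is the Hamming distance from `v` to `w`, so `f w` is one summand.
spheres-cover : ∀ (f : Vec Bool n → ℕ) v w → ∃ λ k → k < suc n × f w ≤ sphere k f v
spheres-cover f []      []      = 0 , ≤-refl , ≤-refl
spheres-cover f (b ∷ v) (c ∷ w) with b Bool.≟ c
... | no b≢c with refl ← Bool.¬-not (b≢c ∘ sym) =
  let k , k≤n , fw≤ = spheres-cover (f ∘ (not b ∷_)) v w in
  suc k , s≤s k≤n , ≤-trans fw≤ (m≤n+m _ _)
... | yes refl with spheres-cover (f ∘ (b ∷_)) v w
...   | zero  , _   , fw≤ = 0 , s≤s z≤n , fw≤
...   | suc k , k<n , fw≤ = suc k , m<n⇒m<1+n k<n , ≤-trans fw≤ (m≤m+n _ _)

∑-⟦≟⟧ : ∀ (x : Fin m) (g : Fin m → ℕ) → ∑[ i < m ] (⟦ x Fin.≟ i ⟧ * g i) ≡ g x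
∑-⟦≟⟧ {suc m} zero    g =
  trans (cong (1 * g zero +_) (sum-replicate-zero m)) (trans (+-identityʳ _) (*-identityˡ _))
∑-⟦≟⟧ {suc m} (suc x) g = ∑-⟦≟⟧ x (g ∘ suc)

-- Grouping neighbours by colour turns a sum over neighbours into a product with a row of neighbour
-- counts.
sphere-1-∘ : ∀ (c : Vec Bool n → Fin m) (g : Fin m → ℕ) v →
  sphere 1 (g ∘ c) v ≡ ∑[ i < m ] (sphere 1 (λ w → ⟦ c w Fin.≟ i ⟧) v * g i)
sphere-1-∘ {m = m} c g []      = sym (sum-replicate-zero m)
sphere-1-∘ {m = m} c g (b ∷ v) = begin
  sphere 1 (g ∘ c ∘ (b ∷_)) v + g (c (not b ∷ v))
    ≡⟨ cong₂ _+_ (sphere-1-∘ (c ∘ (b ∷_)) g v) (sym (∑-⟦≟⟧ (c (not b ∷ v)) g)) ⟩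
  ∑[ i < m ] (s i * g i) + ∑[ i < m ] (t i * g i)
    ≡⟨ ∑-distrib-+ (λ i → s i * g i) (λ i → t i * g i) ⟨
  ∑[ i < m ] (s i * g i + t i * g i)
    ≡⟨ sum-cong-≗ (λ i → *-distribʳ-+ (g i) (s i) (t i)) ⟨
  ∑[ i < m ] ((s i + t i) * g i) ∎
  where
  open ≡-Reasoning
  s = λ i → sphere 1 (λ w → ⟦ c (b ∷ w) Fin.≟ i ⟧) v
  t = λ i → ⟦ c (not b ∷ v) Fin.≟ i ⟧

-- Counting neighbours in the list of vertices

length-filter-map : ∀ {A B : Set} {P : Pred B 0ℓ} (P? : U.Decidable P) (f : A → B) xs →
  length (filter P? (map f xs)) ≡ length (filter (P? ∘ f) xs)
length-filter-map P? f []       = refl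
length-filter-map P? f (x ∷ xs) with does (P? (f x))
... | true  = cong suc (length-filter-map P? f xs)
... | false = length-filter-map P? f xs

count : ∀ {P : Pred (Vec Bool n) 0ℓ} → U.Decidable P → ℕ
count {n} P? = length (filter P? (bitVectors n))

count-cong : ∀ {P Q : Pred (Vec Bool n) 0ℓ} (P? : U.Decidable P) (Q? : U.Decidable Q) →
  P ≐ Q → count P? ≡ count Q?
count-cong {n} P? Q? P≐Q = cong length (filter-≐ P? Q? P≐Q (bitVectors n))

count-∷ : ∀ {P : Pred (Vec Bool (suc n)) 0ℓ} (P? : U.Decidable P) b →
  count P? ≡ count (P? ∘ (b ∷_)) + count (P? ∘ (not b ∷_))
count-∷ {n} P? b = trans halves (swap b)
  where
  halves : count P? ≡ count (P? ∘ (false ∷_)) + count (P? ∘ (true ∷_))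
  halves = begin
    length (filter P? (F ++ T ++ []))
      ≡⟨ cong (λ xs → length (filter P? (F ++ xs))) (++-identityʳ T) ⟩
    length (filter P? (F ++ T))
      ≡⟨ cong length (filter-++ P? F T) ⟩
    length (filter P? F ++ filter P? T)
      ≡⟨ length-++ (filter P? F) ⟩
    length (filter P? F) + length (filter P? T)
      ≡⟨ cong₂ _+_ (length-filter-map P? (false ∷_) (bitVectors n))
                   (length-filter-map P? (true ∷_) (bitVectors n)) ⟩
    count (P? ∘ (false ∷_)) + count (P? ∘ (true ∷_)) ∎
    where
    open ≡-Reasoning
    F = map (false ∷_) (bitVectors n)
    T = map (true ∷_) (bitVectors n)

  swap : ∀ b → count (P? ∘ (false ∷_)) + count (P? ∘ (true ∷_))
             ≡ count (P? ∘ (b ∷_)) + count (P? ∘ (not b ∷_))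
  swap false = refl
  swap true  = +-comm (count (P? ∘ (false ∷_))) _

count-none : ∀ {P : Pred (Vec Bool n) 0ℓ} (P? : U.Decidable P) → (∀ w → ¬ P w) → count P? ≡ 0
count-none {n} P? ¬P = cong length (filter-none P? (All.universal ¬P (bitVectors n)))

length-filter-[_] : ∀ {A : Set} {P : Pred A 0ℓ} x (P? : U.Decidable P) →
  length (filter P? (x ∷ [])) ≡ ⟦ P? x ⟧
length-filter-[ x ] P? with does (P? x)
... | true  = refl
... | false = refl

_≟ᵛ_ : Decidable (_≡_ {A = Vec Bool n})
_≟ᵛ_ = Vec.≡-dec Bool._≟_

-- Counts the single neighbour that a vertex has in the half where its first bit is flipped.
count-≡ : ∀ {P : Pred (Vec Bool n) 0ℓ} (P? : U.Decidable P) v →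
  count (λ w → (v ≟ᵛ w) ×-dec P? w) ≡ ⟦ P? v ⟧
count-≡ P? [] = length-filter-[ [] ] (λ w → ([] ≟ᵛ w) ×-dec P? w)
count-≡ {suc n} {P} P? (b ∷ v) = begin
  count Q?                                              ≡⟨ count-∷ Q? b ⟩
  count (Q? ∘ (b ∷_)) + count (Q? ∘ (not b ∷_))
    ≡⟨ cong₂ _+_ (count-cong (Q? ∘ (b ∷_)) (λ w → (v ≟ᵛ w) ×-dec P? (b ∷ w))
                    (Product.map₁ Vec.∷-injectiveʳ , Product.map₁ (cong (b ∷_))))
                 (count-none (Q? ∘ (not b ∷_))
                    λ w → Bool.not-¬ refl ∘ Vec.∷-injectiveˡ ∘ proj₁) ⟩
  count (λ w → (v ≟ᵛ w) ×-dec P? (b ∷ w)) + 0           ≡⟨ +-identityʳ _ ⟩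
  count (λ w → (v ≟ᵛ w) ×-dec P? (b ∷ w))               ≡⟨ count-≡ (P? ∘ (b ∷_)) v ⟩
  ⟦ P? (b ∷ v) ⟧                                        ∎
  where
  open ≡-Reasoning
  Q? : U.Decidable (λ w → b ∷ v ≡ w × P w)
  Q? = λ w → ((b ∷ v) ≟ᵛ w) ×-dec P? w

-- Adjacency in the hypercube, split on the first coordinate

DifferInOne-∷ : ∀ b {v w : Vec Bool n} → DifferInOne v w → DifferInOne (b ∷ v) (b ∷ w)
DifferInOne-∷ b (i , d , u) =
  suc i , d , λ { {zero} d′ → contradiction refl d′ ; {suc j} d′ → cong suc (u d′) }

DifferInOne-∷⁻ : ∀ b {v w : Vec Bool n} → DifferInOne (b ∷ v) (b ∷ w) → DifferInOne v w
DifferInOne-∷⁻ b (zero  , d , u) = contradiction refl d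
DifferInOne-∷⁻ b (suc i , d , u) = i , d , λ d′ → Fin.suc-injective (u d′)

DifferInOne-not : ∀ b (v : Vec Bool n) → DifferInOne (b ∷ v) (not b ∷ v)
DifferInOne-not b v =
  zero , Bool.not-¬ refl , λ { {zero} d → refl ; {suc j} d → contradiction refl d }

DifferInOne-not⁻ : ∀ b {v w : Vec Bool n} → DifferInOne (b ∷ v) (not b ∷ w) → v ≡ w
DifferInOne-not⁻ b {v} {w} (i , d , u) =
  trans (sym (Vec.tabulate∘lookup v)) (trans (Vec.tabulate-cong agree) (Vec.tabulate∘lookup w))
  where
  -- The first bits differ, so by uniqueness `zero` is the only place of difference.
  i≡0 = u {zero} (Bool.not-¬ refl)
  agree : ∀ j → lookup v j ≡ lookup w j
  agree j with lookup v j Bool.≟ lookup w j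
  ... | yes eq = eq
  ... | no  d′ = contradiction (trans (sym i≡0) (u {suc j} d′)) λ ()

-- Links the list-based count in `neighbours` to the recursive `sphere 1`, on which the recurrence
-- is available.
count-neighbours : ∀ {P : Pred (Vec Bool n) 0ℓ} (P? : U.Decidable P) v →
  count (λ w → differInOne? v w ×-dec P? w) ≡ sphere 1 (λ w → ⟦ P? w ⟧) v
count-neighbours P? [] = refl
count-neighbours {suc n} {P} P? (b ∷ v) = begin
  count Q?                                              ≡⟨ count-∷ Q? b ⟩
  count (Q? ∘ (b ∷_)) + count (Q? ∘ (not b ∷_))
    ≡⟨ cong₂ _+_
         (count-cong (Q? ∘ (b ∷_)) (λ w → differInOne? v w ×-dec P? (b ∷ w))
            (Product.map₁ (DifferInOne-∷⁻ b) , Product.map₁ (DifferInOne-∷ b)))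
         (count-cong (Q? ∘ (not b ∷_)) (λ w → (v ≟ᵛ w) ×-dec P? (not b ∷ w))
            (Product.map₁ (DifferInOne-not⁻ b) , Product.map₁ λ { refl → DifferInOne-not b v })) ⟩
  count (λ w → differInOne? v w ×-dec P? (b ∷ w)) + count (λ w → (v ≟ᵛ w) ×-dec P? (not b ∷ w))
    ≡⟨ cong₂ _+_ (count-neighbours (P? ∘ (b ∷_)) v) (count-≡ (P? ∘ (not b ∷_)) v) ⟩
  sphere 1 (λ w → ⟦ P? w ⟧) (b ∷ v)                     ∎
  where
  open ≡-Reasoning
  Q? : U.Decidable (λ w → DifferInOne (b ∷ v) w × P w)
  Q? = λ w → differInOne? (b ∷ v) w ×-dec P? w

-- Feasible matrices

-- Truncated subtraction and rounded division give junk for a general A; the first half of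
-- Feasible says that neither happens.
sphereMatrix : ℕ → Matrix m → ℕ → Fin m → Fin m → ℕ
sphereMatrix     n A zero          i j = ⟦ i Fin.≟ j ⟧
sphereMatrix     n A (suc zero)    i j = entry A i j
sphereMatrix {m} n A (suc (suc k)) i j =
  (∑[ l < m ] (entry A i l * sphereMatrix n A (suc k) l j) + k * sphereMatrix n A k i j
     ∸ n * sphereMatrix n A k i j) / (2 + k)

Feasible : ℕ → Matrix m → Set
Feasible {m} n A =
  (∀ {k} → k < n → ∀ i j →
     ∑[ l < m ] (entry A i l * sphereMatrix n A (suc k) l j) + k * sphereMatrix n A k i j
       ≡ n * sphereMatrix n A k i j + (2 + k) * sphereMatrix n A (2 + k) i j)
  × (∀ i j → ∃ λ k → k < suc n × 0 < sphereMatrix n A k i j)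

feasible? : ∀ n → U.Decidable (Feasible {m} n)
feasible? n A =
  allUpTo? (λ k → Fin.all? λ i → Fin.all? λ j → _ ≟ _) n
  ×-dec Fin.all? λ i → Fin.all? λ j → anyUpTo? (λ k → 0 <? sphereMatrix n A k i j) (suc n)

-- Feasibility of the matrix of a perfect colouring

module _ (P : PerfectColouring (Q n) m) where
  open PerfectColouring P renaming (matrix to A)

  class : Fin m → Vec Bool n → ℕ
  class j w = ⟦ colour w Fin.≟ j ⟧

  -- On functions that factor through the colour, the adjacency operator of the cube acts as
  -- multiplication by `A`.
  sphere-1-colour : ∀ (g : Fin m → ℕ) v →
    sphere 1 (g ∘ colour) v ≡ ∑[ i < m ] (entry A (colour v) i * g i)
  sphere-1-colour g v = trans (sphere-1-∘ colour g v) (sum-cong-≗ λ i →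
    cong (_* g i) (trans (sym (count-neighbours (λ w → colour w Fin.≟ i) v)) (perfect _ i v refl)))

  -- The last term stays a genuine sphere count, so that the division by `2 + k` is visibly exact.
  colour-recurrence : ∀ k j →
    (∀ w → sphere k (class j) w ≡ sphereMatrix n A k (colour w) j) →
    (∀ w → sphere (suc k) (class j) w ≡ sphereMatrix n A (suc k) (colour w) j) → ∀ v →
    ∑[ i < m ] (entry A (colour v) i * sphereMatrix n A (suc k) i j)
      + k * sphereMatrix n A k (colour v) j
    ≡ n * sphereMatrix n A k (colour v) j + (2 + k) * sphere (2 + k) (class j) v
  colour-recurrence k j eqₖ eqₖ₊₁ v = begin
    ∑[ i < m ] (entry A (colour v) i * sphereMatrix n A (suc k) i j) + k * D
      ≡⟨ cong (_+ k * D) (sphere-1-colour (λ i → sphereMatrix n A (suc k) i j) v) ⟨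
    sphere 1 (λ w → sphereMatrix n A (suc k) (colour w) j) v + k * D
      ≡⟨ cong₂ _+_ (sphere-cong 1 eqₖ₊₁ v) (cong (k *_) (eqₖ v)) ⟨
    sphere 1 (sphere (suc k) (class j)) v + k * sphere k (class j) v
      ≡⟨ sphere-recurrence k (class j) v ⟩
    n * sphere k (class j) v + (2 + k) * S
      ≡⟨ cong (λ x → n * x + (2 + k) * S) (eqₖ v) ⟩
    n * D + (2 + k) * S ∎
    where
    open ≡-Reasoning
    D = sphereMatrix n A k (colour v) j
    S = sphere (2 + k) (class j) v

  -- Two-step induction: the numerator equals `nD + (2 + k) * S`, so neither truncation nor rounding
  -- occurs.
  sphere-colour : ∀ k j v → sphere k (class j) v ≡ sphereMatrix n A k (colour v) j
  sphere-colour zero          j v = refl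
  sphere-colour (suc zero)    j v =
    trans (sym (count-neighbours (λ w → colour w Fin.≟ j) v)) (perfect _ j v refl)
  sphere-colour (suc (suc k)) j v = sym (begin
    (∑[ i < m ] (entry A (colour v) i * sphereMatrix n A (suc k) i j)
       + k * sphereMatrix n A k (colour v) j ∸ nD) / (2 + k)
      ≡⟨ cong (λ x → (x ∸ nD) / (2 + k))
           (colour-recurrence k j (sphere-colour k j) (sphere-colour (suc k) j) v) ⟩
    (nD + (2 + k) * S ∸ nD) / (2 + k)
      ≡⟨ cong (_/ (2 + k)) (m+n∸m≡n nD _) ⟩
    (2 + k) * S / (2 + k)
      ≡⟨ cong (_/ (2 + k)) (*-comm (2 + k) S) ⟩
    S * (2 + k) / (2 + k)
      ≡⟨ m*n/n≡m S (2 + k) ⟩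
    S ∎)
    where
    open ≡-Reasoning
    nD = n * sphereMatrix n A k (colour v) j
    S = sphere (2 + k) (class j) v

  matrix-feasible : Feasible n A
  matrix-feasible = recurrence , covered
    where
    recurrence : ∀ {k} → k < n → ∀ i j → _
    -- Every colour is that of some vertex, so identities between counts become identities between
    -- matrix entries.
    recurrence {k} _ i j with nonempty i
    ... | v , refl = trans
      (colour-recurrence k j (sphere-colour k j) (sphere-colour (suc k) j) v)
      (cong (λ x → n * sphereMatrix n A k (colour v) j + (2 + k) * x) (sphere-colour (2 + k) j v))

    covered : ∀ i j → ∃ λ k → k < suc n × 0 < sphereMatrix n A k i j
    covered i j with nonempty i | nonempty j
    ... | v , refl | w , refl with spheres-cover (class (colour w)) v w
    ...   | k , k≤n , one≤ = k , k≤n , subst₂ _≤_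
      (cong (λ b → if b then 1 else 0) (dec-true (colour w Fin.≟ colour w) refl)) (sphere-colour k _ v) one≤

  -- The adjacency operator is applied to the constant function 1, which yields the degree `n`.
  row-sum : ∀ i → ∑[ j < m ] entry A i j ≡ n
  row-sum i with nonempty i
  ... | v , refl = begin
    ∑[ j < m ] entry A (colour v) j        ≡⟨ sum-cong-≗ (λ j → *-identityʳ (entry A (colour v) j)) ⟨
    ∑[ j < m ] (entry A (colour v) j * 1)  ≡⟨ sphere-1-colour (const 1) v ⟨
    sphere 1 (const 1) v                   ≡⟨ sphere-1-const v ⟩
    n                                      ∎
    where open ≡-Reasoning

-- Enumeration of the candidate matrices

words : ∀ {A : Set} → List A → ∀ n → List (Vec A n)
words xs zero    = [] ∷ []
words xs (suc n) = cartesianProductWith _∷_ xs (words xs n)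

∈-words : ∀ {A : Set} {xs : List A} {n} {v : Vec A n} → (∀ i → lookup v i ∈ xs) → v ∈ words xs n
∈-words {v = []}    v∈ = here refl
∈-words {v = x ∷ v} v∈ = ∈-cartesianProductWith⁺ _∷_ (v∈ zero) (∈-words (v∈ ∘ suc))

lookup≤∑ : ∀ (v : Vec ℕ m) i → lookup v i ≤ ∑[ j < m ] lookup v j
lookup≤∑ (x ∷ v) zero    = m≤m+n x _
lookup≤∑ (x ∷ v) (suc i) = ≤-trans (lookup≤∑ v i) (m≤n+m _ x)

rows : ℕ → ∀ m → List (Vec ℕ m)
rows n m = filter (λ v → ∑[ j < m ] lookup v j ≟ n) (words (upTo (suc n)) m)

-- No entry exceeds the row sum, so the alphabet `upTo (suc n)` suffices.
∈-rows : ∀ (v : Vec ℕ m) → ∑[ j < m ] lookup v j ≡ n → v ∈ rows n m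
∈-rows v refl = ∈-filter⁺ _ (∈-words λ i → ∈-upTo⁺ (s≤s (lookup≤∑ v i))) refl

-- Permutation similarity

permutations : ∀ n → List (Permutation′ n)
permutations zero    = id ∷ []
permutations (suc n) = cartesianProductWith (insert zero) (allFin (suc n)) (permutations n)

insert-zero-cong : ∀ j {π ρ : Permutation′ n} → π ≈ ρ → insert zero j π ≈ insert zero j ρ
insert-zero-cong j π≈ρ zero    = refl
insert-zero-cong j π≈ρ (suc k) = cong (punchIn j) (π≈ρ k)

-- A permutation is determined by the image of `zero` and what remains after removing it. Being made
-- of functions, it is matched only up to pointwise equality.
permutations-complete : ∀ (π : Permutation′ n) → Any (π ≈_) (permutations n)
permutations-complete {zero}  π = here λ ()
permutations-complete {suc n} π = Any.cartesianProductWith⁺ (insert zero)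
  (λ { {y = ρ} refl π′≈ρ i → trans (sym (insert-remove zero π i))
                                 (insert-zero-cong (π ⟨$⟩ʳ zero) {ρ = ρ} π′≈ρ i) })
  (∈-allFin (π ⟨$⟩ʳ zero)) (permutations-complete (remove zero π))

_∼?_ : Decidable (_∼_ {m})
_∼?_ {m} A B = map′ Any.satisfied enumerate
  (Any.any? (λ σ → Fin.all? λ i → Fin.all? λ j → _ ≟ _) (permutations m))
  where
  enumerate : A ∼ B →
    Any (λ σ → ∀ i j → entry A i j ≡ entry B (σ ⟨$⟩ʳ i) (σ ⟨$⟩ʳ j)) (permutations m)
  enumerate (π , A≡B) = Any.map
    (λ π≈σ i j → trans (A≡B i j) (cong₂ (entry B) (π≈σ i) (π≈σ j))) (permutations-complete π)

-- Recolouring by the inverse of `σ` makes the new class `i` the old class `σ i`.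
∼-resp-colourAdjacency : ∀ G {A B : Matrix m} →
  A ∼ B → IsColourAdjacencyMatrix G B → IsColourAdjacencyMatrix G A
∼-resp-colourAdjacency G {A} (σ , A≡B) (P , refl) = record
  { colouring = record
    { colour   = λ v → σ ⟨$⟩ˡ colour v
    ; nonempty = λ i → let v , cv≡σi = nonempty (σ ⟨$⟩ʳ i) in
        v , trans (cong (σ ⟨$⟩ˡ_) cv≡σi) (inverseˡ σ)
    }
  ; matrix  = A
  ; perfect = λ { i j v refl → begin
      length (filter _ vertices)
        ≡⟨ cong length (filter-≐ _ (λ w → adj? v w ×-dec (colour w Fin.≟ σ ⟨$⟩ʳ j))
             ( Product.map₂ (λ eq → trans (sym (inverseʳ σ)) (cong (σ ⟨$⟩ʳ_) eq))
             , Product.map₂ (λ eq → trans (cong (σ ⟨$⟩ˡ_) eq) (inverseˡ σ))) vertices) ⟩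
      neighbours v (σ ⟨$⟩ʳ j)
        ≡⟨ perfect _ _ v (sym (inverseʳ σ)) ⟩
      entry matrix (σ ⟨$⟩ʳ (σ ⟨$⟩ˡ colour v)) (σ ⟨$⟩ʳ j)
        ≡⟨ A≡B _ j ⟨
      entry A (σ ⟨$⟩ˡ colour v) j ∎ }
  } , refl
  where
  open PerfectColouring P
  open FiniteGraph G
  open ≡-Reasoning

-- Realisation

-- Stated with the recursive `sphere 1`, so that deciding it evaluates no adjacency test.
Realises : (Vec Bool n → Fin m) → Matrix m → Set
Realises c A =
  (∀ i → ∃ λ v → c v ≡ i)
  × (∀ v j → sphere 1 (λ w → ⟦ c w Fin.≟ j ⟧) v ≡ entry A (c v) j)

realises? : ∀ (c : Vec Bool n → Fin m) A → Dec (Realises c A)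
realises? {n} c A =
  Fin.all? (λ i → map′ Any.satisfied
    (λ (v , cv≡i) → Any.map (λ { refl → cv≡i }) (bitVectors-complete v))
    (Any.any? (λ v → c v Fin.≟ i) (bitVectors n)))
  ×-dec map′ (λ all v → All.lookup all (bitVectors-complete v)) (λ all → All.universal all _)
    (All.all? (λ v → Fin.all? λ j → _ ≟ _) (bitVectors n))

realisation : ∀ (c : Vec Bool n → Fin m) {A} → {True (realises? c A)} →
  IsColourAdjacencyMatrix (Q n) A
realisation c {A} {realises} = record
  { colouring = record { colour = c ; nonempty = proj₁ (toWitness realises) }
  ; matrix    = A
  ; perfect   = λ { _ j v refl →
      trans (count-neighbours (λ w → c w Fin.≟ j) v) (proj₂ (toWitness realises) v j) }
  } , refl

-- Row sums put the matrix of a colouring on the finite candidate list, where feasibility selects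
-- it; conversely, relabelling a realised matrix keeps it realised.
classification : ∀ n (Bs : List (Matrix m)) → All (IsColourAdjacencyMatrix (Q n)) Bs →
  All (λ A → Feasible n A → Any (A ∼_) Bs) (words (rows n m) m) →
  ∀ A → IsColourAdjacencyMatrix (Q n) A ⇔ Any (A ∼_) Bs
classification n Bs realised exhaustive A = mk⇔
  (λ { (P , refl) → All.lookup exhaustive
         (∈-words λ i → ∈-rows (lookup A i) (row-sum P i)) (matrix-feasible P) })
  (λ A∼Bs → let realised-B , A∼B = All.lookupAny realised A∼Bs
            in ∼-resp-colourAdjacency (Q n) A∼B realised-B)

exhaustive? : ∀ n (Bs : List (Matrix m)) →
  Dec (All (λ A → Feasible n A → Any (A ∼_) Bs) (words (rows n m) m))
exhaustive? n Bs = All.all? (λ A → feasible? n A →-dec Any.any? (A ∼?_) Bs) _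

inequivalent? : ∀ (Bs : List (Matrix m)) → Dec (AllPairs (λ B C → ¬ (B ∼ C)) Bs)
inequivalent? = allPairs? λ B C → ¬? (B ∼? C)

-- Explicit colourings of the 4-cube

bit : Bool → Fin (2 + m)
bit b = if b then 1F else 0F

realised₂ : All (IsColourAdjacencyMatrix (Q 4)) matrices₂
realised₂ =
    realisation (λ { (a ∷ b ∷ c ∷ d ∷ []) → bit (a xor b xor c xor d) })
  -- Colour 0 means `a = b = c`: the repetition code of length 3 is perfect, so every other triple
  -- is one flip from exactly one codeword. The remaining colourings are parities of 4, 3, 2 and 1
  -- bits.
  ∷ realisation (λ { (a ∷ b ∷ c ∷ d ∷ []) → bit ((a xor b) ∨ (b xor c)) })
  ∷ realisation (λ { (a ∷ b ∷ c ∷ d ∷ []) → bit (a xor b xor c) })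
  ∷ realisation (λ { (a ∷ b ∷ c ∷ d ∷ []) → bit (a xor b) })
  ∷ realisation (λ { (a ∷ b ∷ c ∷ d ∷ []) → bit a })
  ∷ []

-- The first two split the even vertices; the other three split the half `a = b`. A vertex with
-- `a ≠ b` has two neighbours in that half, with opposite values of `a`, hence one in each part.
realised₃ : All (IsColourAdjacencyMatrix (Q 4)) matrices₃
realised₃ =
    realisation (λ { (a ∷ b ∷ c ∷ d ∷ []) →
      if a xor b xor c xor d then 2F else bit ((a xor b) ∨ (b xor c)) })
  ∷ realisation (λ { (a ∷ b ∷ c ∷ d ∷ []) →
      if a xor b xor c xor d then 2F else bit (a xor b) })
  ∷ realisation (λ { (a ∷ b ∷ c ∷ d ∷ []) →
      if a xor b then 2F else bit (a xor c xor d) })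
  ∷ realisation (λ { (a ∷ b ∷ c ∷ d ∷ []) →
      if a xor b then 2F else bit (a xor c) })
  ∷ realisation (λ { (a ∷ b ∷ c ∷ d ∷ []) →
      if a xor b then 2F else bit a })
  ∷ []

theorem5p1 : ( (∀ (A : Matrix 2) → IsColourAdjacencyMatrix (Q 4) A ⇔ Any (λ B → A ∼ B) matrices₂)
    × All (IsColourAdjacencyMatrix (Q 4)) matrices₂
    × AllPairs (λ B C → ¬ (B ∼ C)) matrices₂ )
    ×
    ( (∀ (A : Matrix 3) → IsColourAdjacencyMatrix (Q 4) A ⇔ Any (λ B → A ∼ B) matrices₃)
    × All (IsColourAdjacencyMatrix (Q 4)) matrices₃
    × AllPairs (λ B C → ¬ (B ∼ C)) matrices₃ )
theorem5p1 =
    -- Settled by evaluation: there are 5 rows and 25 candidates for two colours, 15 rows and 3375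
    -- candidates for three.
    ( classification 4 matrices₂ realised₂ (from-yes (exhaustive? 4 matrices₂))
    , realised₂ , from-yes (inequivalent? matrices₂) )
  , ( classification 4 matrices₃ realised₃ (from-yes (exhaustive? 4 matrices₃))
    , realised₃ , from-yes (inequivalent? matrices₃) )
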